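{- Given correct static weight predictions, the following algorithm is a non-clairvoyant $4$-competitive algorithm for minimizing the total weighted completion time of jobs with online chain precedence constraints on a single machine: maintain $W_c(t)$ for each chain $c$, initialized to the given total weight $W_c$ of $c$; while unfinished jobs remain, at each time $t$ process the front job of every chain $c$ at rate $W_c(t)/\sum_{c'}W_{c'}(t)$ and, whenever a job $j$ of chain $c$ finishes, decrease $W_c$ by $w_j$; chains with remaining weight $0$ are processed at the end in arbitrary order.
   Context: Problem (non-clairvoyant single-machine scheduling with online precedence constraints): jobs with processing requirements $p_j\ge0$ (unknown to the algorithm) and weights $w_j\ge0$; the precedence graph is a collection $\mathcal C$ of disjoint chains (every job has at most one direct predecessor and one direct successor); a job is revealed, with its weight, only once its predecessor is completed, and only then may be processed. Time is discrete; a preemptive schedule assigns rates $R_j^t\ge0$ with $\sum_jR_j^t\le1$; $C_j$ is the first $t$ with $\sum_{t'\le t}R_j^{t'}\ge p_j$. Objective: minimize $\sum_jw_jC_j$, compared with the offline optimum $\mathrm{Opt}$; $\rho$-competitive means $\mathrm{Alg}\le\rho\,\mathrm{Opt}$ always. Static weight predictions for chains: at time $0$ the algorithm is given, for each chain $c\in\mathcal C$, a value which (being correct) equals the total weight $W_c=\sum_{j\in c}w_j$ of the chain.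
   Formalization: Processing requirements, weights and processing rates are taken to be rational numbers instead of real numbers. -}

module Defs where

open import Data.Nat as ℕ using (ℕ; zero; suc)
open import Data.Fin using (Fin; zero; suc)
open import Data.Integer using (+_)
open import Data.Rational using (ℚ; 0ℚ; 1ℚ; _+_; _*_; _÷_; _≤_; _<_; _/_; >-nonZero)
open import Data.Product using (Σ; _×_; _,_)
open import Relation.Nullary using (¬_)
open import Relation.Binary.PropositionalEquality using (_≡_)

toℚ : ℕ → ℚ
toℚ n = + n / 1

sumTo : ℕ → (ℕ → ℚ) → ℚ
sumTo zero    f = 0ℚ
sumTo (suc n) f = sumTo n f + f n

sumFin : (k : ℕ) → (Fin k → ℚ) → ℚ
sumFin zero    f = 0ℚ
sumFin (suc k) f = f zero + sumFin k (λ c → f (suc c))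

-- An instance: k disjoint chains; chain c consists of jobs (c , 0), (c , 1), …,
-- (c , len c - 1) in precedence order; job (c , i) has processing requirement
-- p c i ≥ 0 and weight w c i ≥ 0 (values at indices i ≥ len c are ignored).
record Instance : Set where
  field
    k        : ℕ
    len      : Fin k → ℕ
    p        : Fin k → ℕ → ℚ
    w        : Fin k → ℕ → ℚ
    p-nonneg : ∀ c i → i ℕ.< len c → 0ℚ ≤ p c i
    w-nonneg : ∀ c i → i ℕ.< len c → 0ℚ ≤ w c i

-- A (preemptive, discrete-time) schedule: rate t c i = R^t of job (c , i) in
-- time slot t (slots t = 1, 2, …; slot 0 is never used), and the completion
-- times comp c i = C_{(c,i)}.
record Schedule (I : Instance) : Set where
  open Instance I
  field
    rate : ℕ → Fin k → ℕ → ℚ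
    comp : Fin k → ℕ → ℕ

module _ {I : Instance} (S : Schedule I) where
  open Instance I
  open Schedule S

  release : Fin k → ℕ → ℕ
  release c zero    = 0
  release c (suc i) = comp c i

  processed : Fin k → ℕ → ℕ → ℚ
  processed c i t = sumTo (suc t) (λ t' → rate t' c i)

  record Feasible : Set where
    field
      rate-nonneg : ∀ t c i → i ℕ.< len c → 0ℚ ≤ rate t c i
      capacity    : ∀ t → sumFin k (λ c → sumTo (len c) (λ i → rate t c i)) ≤ 1ℚ
      precedence  : ∀ t c i → i ℕ.< len c → t ℕ.≤ release c i → rate t c i ≡ 0ℚ
      comp-after  : ∀ c i → i ℕ.< len c → release c i ℕ.≤ comp c i
      comp-done   : ∀ c i → i ℕ.< len c → p c i ≤ processed c i (comp c i)
      comp-first  : ∀ c i → i ℕ.< len c → ∀ t → release c i ℕ.≤ t → t ℕ.< comp c i →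
                    processed c i t < p c i

  cost : ℚ
  cost = sumFin k (λ c → sumTo (len c) (λ i → w c i * toℚ (comp c i)))

  -- job (c , i) is unfinished at (the start of) time slot t
  Unfinished : Fin k → ℕ → ℕ → Set
  Unfinished c i t = t ℕ.≤ comp c i

  -- W_c(t): the predicted total weight W_c of chain c minus the weights of its
  -- jobs completed before slot t (correct predictions: W_c = Σ_{j ∈ c} w_j)
  remW : Fin k → ℕ → ℚ
  remW c t = sumTo (len c) (λ i → if? i)
    where
    if? : ℕ → ℚ
    if? i with t ℕ.≤? comp c i
    ... | Relation.Nullary.yes _ = w c i
    ... | Relation.Nullary.no  _ = 0ℚ

  totW : ℕ → ℚ
  totW t = sumFin k (λ c → remW c t)

  IsFront : Fin k → ℕ → ℕ → Set
  IsFront c i t = (i ℕ.< len c) × Unfinished c i t × (∀ i' → i' ℕ.< i → comp c i' ℕ.< t)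

  -- The algorithm: in every slot t ≥ 1 with Σ_c W_c(t) > 0, the front job of
  -- every chain c gets rate W_c(t) / Σ_c' W_c'(t) and all other jobs rate 0.
  -- Once Σ_c W_c(t) = 0 (only zero-weight jobs remain) the remaining jobs may
  -- be processed in any (feasible) way.
  FollowsAlg : Set
  FollowsAlg = ∀ t → 1 ℕ.≤ t → (pos : 0ℚ < totW t) → ∀ c i → i ℕ.< len c →
    (IsFront c i t → rate t c i ≡ (remW c t ÷ totW t) {{>-nonZero pos}}) ×
    (¬ IsFront c i t → rate t c i ≡ 0ℚ)

{-# OPTIONS --safe #-}
module Submission where

-- Write C_j and C*_j for the completion times in the algorithm's schedule and in
-- the competing one, and W(t) for the algorithm's total unfinished weight, so
-- that Alg = Σ_t W(t). The lag ℓ_j = max(0, C_j − 2 C*_j) satisfies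
-- Alg ≤ 2 Opt + Σ_j w_j ℓ_j, and summing by parts along a chain turns Σ_j w_j ℓ_j
-- into the sum of (increase of the lag at job i) × (weight of i and its successors).
-- If the lag increases by n at job i, there are n slots t ≥ 2 C*_i before slot C_i in
-- which the algorithm processes i at a rate of at least (that weight) / W(t), where
-- W(t) ≤ W(2 C*_i); as these slots do not complete i, the summand is at most
-- p_i W(2 C*_i). Paying W(2s) per unit of work done by the competing schedule in
-- slot s covers all of these terms, and Σ_s W(2s) ≤ ½ Σ_t W(t) = ½ Alg. Hence
-- Alg ≤ 2 Opt + ½ Alg.

open import Defs
open import Data.Nat as ℕ using (ℕ; zero; suc; z≤n; s≤s)
import Data.Nat.Properties as ℕ
open import Data.Fin using (Fin; zero; suc)
open import Data.Fin.Properties using (all?; ¬∀⟶∃¬)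
import Data.Integer as ℤ
import Data.Integer.Properties as ℤ
open import Data.Integer using (+_)
open import Data.Rational using (ℚ; mkℚ; 0ℚ; 1ℚ; _+_; _*_; _÷_; 1/_; _/_; ↥_; _≤_; _<_; *≤*; _<?_; _≤?_; NonZero; nonNegative; positive; >-nonZero)
open import Data.Rational.Properties
open import Data.Rational.Solver using (module +-*-Solver)
import Data.Rational.Unnormalised as ℚᵘ
import Data.Rational.Unnormalised.Properties as ℚᵘ
open import Data.Product using (Σ; ∃-syntax; _×_; _,_; proj₁; proj₂)
open import Data.Sum using (inj₁; inj₂)
open import Function using (_∘_)
open import Relation.Nullary using (¬_; Dec; yes; no; contradiction)
open import Relation.Binary.PropositionalEquality using (_≡_; refl; sym; trans; cong; cong₂; subst)

-- Here (a , b] and (a* , b*] are the slots of one job in the two schedules. The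
-- strict a* < b* absorbs the loss of slot b, which may be used only partially.
lag-window : ∀ {a b a* b*} → a* ℕ.< b* → ∀ n → suc n ≡ (b ℕ.∸ b* ℕ.* 2) ℕ.∸ (a ℕ.∸ a* ℕ.* 2) →
  (b* ℕ.* 2 ℕ.+ suc n ℕ.≤ b) × (a ℕ.+ suc n ℕ.< b)
lag-window {a} {b} {a*} {b*} a*<b* n eq = not-before-2b* , after-a
  where
  open ℕ.≤-Reasoning
  x y : ℕ
  x = b ℕ.∸ b* ℕ.* 2
  y = a ℕ.∸ a* ℕ.* 2
  y<x : y ℕ.< x
  y<x = ℕ.≰⇒> λ x≤y → ℕ.1+n≢0 (trans eq (ℕ.m≤n⇒m∸n≡0 x≤y))
  x≡ : suc n ℕ.+ y ≡ x
  x≡ = trans (cong (ℕ._+ y) eq) (ℕ.m∸n+n≡m (ℕ.<⇒≤ y<x))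
  2b*≤b : b* ℕ.* 2 ℕ.≤ b
  2b*≤b = ℕ.≰⇒≥ λ b≤ → ℕ.n≮0 (subst (y ℕ.<_) (ℕ.m≤n⇒m∸n≡0 b≤) y<x)
  b≡ : b* ℕ.* 2 ℕ.+ x ≡ b
  b≡ = ℕ.m+[n∸m]≡n 2b*≤b
  not-before-2b* : b* ℕ.* 2 ℕ.+ suc n ℕ.≤ b
  not-before-2b* = subst (b* ℕ.* 2 ℕ.+ suc n ℕ.≤_) b≡
    (ℕ.+-monoʳ-≤ (b* ℕ.* 2) (subst (suc n ℕ.≤_) x≡ (ℕ.m≤m+n (suc n) y)))
  after-a : a ℕ.+ suc n ℕ.< b
  after-a = begin-strict
    a ℕ.+ suc n                        ≤⟨ ℕ.+-monoˡ-≤ (suc n) (ℕ.m≤n+m∸n a (a* ℕ.* 2)) ⟩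
    a* ℕ.* 2 ℕ.+ y ℕ.+ suc n           <⟨ ℕ.+-monoˡ-< (suc n) (ℕ.+-monoˡ-< y (ℕ.*-monoˡ-< 2 a*<b*)) ⟩
    b* ℕ.* 2 ℕ.+ y ℕ.+ suc n           ≡⟨ ℕ.+-assoc (b* ℕ.* 2) y (suc n) ⟩
    b* ℕ.* 2 ℕ.+ (y ℕ.+ suc n)         ≡⟨ cong (b* ℕ.* 2 ℕ.+_) (trans (ℕ.+-comm y (suc n)) x≡) ⟩
    b* ℕ.* 2 ℕ.+ x                     ≡⟨ b≡ ⟩
    b                                  ∎

open ≤-Reasoning

-- Rational arithmetic

-- `+ n / 1` is normalised by a gcd and does not compute for a variable `n`, so the identity is
-- verified on unnormalised rationals.
toℚ-suc : ∀ n → toℚ (suc n) ≡ toℚ n + 1ℚ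
toℚ-suc n = toℚᵘ-injective (ℚᵘ.≃-trans (toℚᵘ-fromℚᵘ (ℚᵘ.mkℚᵘ (+ suc n) 0))
  (ℚᵘ.≃-sym (ℚᵘ.≃-trans (toℚᵘ-homo-+ (toℚ n) 1ℚ)
    (ℚᵘ.≃-trans (ℚᵘ.+-congˡ ℚᵘ.1ℚᵘ (toℚᵘ-fromℚᵘ (ℚᵘ.mkℚᵘ (+ n) 0)))
      (ℚᵘ.*≡* (cong (ℤ._* (+ 1)) (trans (cong (ℤ._+ (+ 1)) (ℤ.*-identityʳ (+ n))) (ℤ.+-comm (+ n) (+ 1)))))))))

*-monoʳ-≤ : ∀ {a b c} → 0ℚ ≤ c → a ≤ b → a * c ≤ b * c
*-monoʳ-≤ {c = c} 0≤c = *-monoʳ-≤-nonNeg c {{nonNegative 0≤c}}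

*-monoˡ-≤ : ∀ {a b c} → 0ℚ ≤ c → a ≤ b → c * a ≤ c * b
*-monoˡ-≤ {c = c} 0≤c = *-monoˡ-≤-nonNeg c {{nonNegative 0≤c}}

*-nonneg : ∀ {a b} → 0ℚ ≤ a → 0ℚ ≤ b → 0ℚ ≤ a * b
*-nonneg {a} {b} 0≤a 0≤b = subst (_≤ a * b) (*-zeroˡ b) (*-monoʳ-≤ 0≤b 0≤a)

≤-+ʳ : ∀ {a b} → 0ℚ ≤ b → a ≤ a + b
≤-+ʳ {a} {b} 0≤b = subst (_≤ a + b) (+-identityʳ a) (+-monoʳ-≤ a 0≤b)

≤-+ˡ : ∀ {a b} → 0ℚ ≤ b → a ≤ b + a
≤-+ˡ {a} {b} 0≤b = subst (_≤ b + a) (+-identityˡ a) (+-monoˡ-≤ a 0≤b)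

+-nonneg : ∀ {a b} → 0ℚ ≤ a → 0ℚ ≤ b → 0ℚ ≤ a + b
+-nonneg 0≤a 0≤b = ≤-trans 0≤a (≤-+ʳ 0≤b)

+-cancelʳ-≤ : ∀ {a b} c → a + c ≤ b + c → a ≤ b
+-cancelʳ-≤ {a} {b} c le with a <? b
... | yes a<b = <⇒≤ a<b
... | no  a≮b = ≮⇒≥ λ b<a → <-irrefl refl (<-≤-trans (+-monoˡ-< c b<a) le)

+-interchange : ∀ a b c d → (a + b) + (c + d) ≡ (a + c) + (b + d)
+-interchange = solve 4 (λ a b c d → (a :+ b) :+ (c :+ d) := (a :+ c) :+ (b :+ d)) refl
  where open +-*-Solver

0≤1 : 0ℚ ≤ 1ℚ
0≤1 = *≤* (ℤ.+≤+ z≤n)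

toℚ-nonneg : ∀ n → 0ℚ ≤ toℚ n
toℚ-nonneg zero    = ≤-refl
toℚ-nonneg (suc n) = subst (0ℚ ≤_) (sym (toℚ-suc n)) (+-nonneg (toℚ-nonneg n) 0≤1)

toℚ-+ : ∀ m n → toℚ (m ℕ.+ n) ≡ toℚ m + toℚ n
toℚ-+ zero    n = sym (+-identityˡ (toℚ n))
toℚ-+ (suc m) n = begin-equality
  toℚ (suc (m ℕ.+ n))     ≡⟨ toℚ-suc (m ℕ.+ n) ⟩
  toℚ (m ℕ.+ n) + 1ℚ      ≡⟨ cong (_+ 1ℚ) (toℚ-+ m n) ⟩
  toℚ m + toℚ n + 1ℚ      ≡⟨ solve 3 (λ a b c → a :+ b :+ c := a :+ c :+ b) refl (toℚ m) (toℚ n) 1ℚ ⟩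
  toℚ m + 1ℚ + toℚ n      ≡⟨ cong (_+ toℚ n) (toℚ-suc m) ⟨
  toℚ (suc m) + toℚ n     ∎
  where open +-*-Solver

toℚ-mono : ∀ {m n} → m ℕ.≤ n → toℚ m ≤ toℚ n
toℚ-mono {m} {n} m≤n = subst (toℚ m ≤_) (trans (sym (toℚ-+ m (n ℕ.∸ m))) (cong toℚ (ℕ.m+[n∸m]≡n m≤n)))
  (≤-+ʳ (toℚ-nonneg (n ℕ.∸ m)))

*-toℚ-suc : ∀ a n → a * toℚ (suc n) ≡ a * toℚ n + a
*-toℚ-suc a n = trans (cong (a *_) (toℚ-suc n))
  (trans (*-distribˡ-+ a (toℚ n) 1ℚ) (cong (λ z → a * toℚ n + z) (*-identityʳ a)))

÷-*-cancel : ∀ a b .{{_ : NonZero b}} → (a ÷ b) * b ≡ a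
÷-*-cancel a b = trans (*-assoc a (1/ b) b) (trans (cong (a *_) (*-inverseˡ b)) (*-identityʳ a))

-- Finite sums

sumTo-cong : ∀ n {f g : ℕ → ℚ} → (∀ i → f i ≡ g i) → sumTo n f ≡ sumTo n g
sumTo-cong zero    f≡g = refl
sumTo-cong (suc n) f≡g = cong₂ _+_ (sumTo-cong n f≡g) (f≡g n)

sumTo-mono : ∀ n {f g : ℕ → ℚ} → (∀ i → i ℕ.< n → f i ≤ g i) → sumTo n f ≤ sumTo n g
sumTo-mono zero    f≤g = ≤-refl
sumTo-mono (suc n) f≤g = +-mono-≤ (sumTo-mono n λ i i<n → f≤g i (ℕ.m≤n⇒m≤1+n i<n)) (f≤g n (ℕ.n<1+n n))

sumTo-0 : ∀ n → sumTo n (λ _ → 0ℚ) ≡ 0ℚ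
sumTo-0 zero    = refl
sumTo-0 (suc n) = trans (+-identityʳ _) (sumTo-0 n)

sumTo-nonneg : ∀ n {f : ℕ → ℚ} → (∀ i → i ℕ.< n → 0ℚ ≤ f i) → 0ℚ ≤ sumTo n f
sumTo-nonneg n {f} 0≤f = subst (_≤ sumTo n f) (sumTo-0 n) (sumTo-mono n 0≤f)

sumTo-+ : ∀ n (f g : ℕ → ℚ) → sumTo n (λ i → f i + g i) ≡ sumTo n f + sumTo n g
sumTo-+ zero    f g = refl
sumTo-+ (suc n) f g = trans (cong (_+ (f n + g n)) (sumTo-+ n f g)) (+-interchange (sumTo n f) (sumTo n g) (f n) (g n))

sumTo-*ˡ : ∀ n a (f : ℕ → ℚ) → sumTo n (λ i → a * f i) ≡ a * sumTo n f
sumTo-*ˡ zero    a f = sym (*-zeroʳ a)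
sumTo-*ˡ (suc n) a f = trans (cong (_+ a * f n) (sumTo-*ˡ n a f)) (sym (*-distribˡ-+ a (sumTo n f) (f n)))

sumTo-*ʳ : ∀ n a (f : ℕ → ℚ) → sumTo n (λ i → f i * a) ≡ sumTo n f * a
sumTo-*ʳ n a f = trans (sumTo-cong n λ i → *-comm (f i) a) (trans (sumTo-*ˡ n a f) (*-comm a _))

sumTo-const : ∀ n a → sumTo n (λ _ → a) ≡ a * toℚ n
sumTo-const zero    a = sym (*-zeroʳ a)
sumTo-const (suc n) a = trans (cong (_+ a) (sumTo-const n a)) (sym (*-toℚ-suc a n))

sumTo-++ : ∀ m n (f : ℕ → ℚ) → sumTo (m ℕ.+ n) f ≡ sumTo m f + sumTo n (λ i → f (m ℕ.+ i))
sumTo-++ m zero    f = trans (cong (λ z → sumTo z f) (ℕ.+-identityʳ m)) (sym (+-identityʳ _))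
sumTo-++ m (suc n) f = trans (cong (λ z → sumTo z f) (ℕ.+-suc m n))
  (trans (cong (_+ f (m ℕ.+ n)) (sumTo-++ m n f))
    (+-assoc (sumTo m f) (sumTo n (λ i → f (m ℕ.+ i))) (f (m ℕ.+ n))))

sumTo-extend : ∀ {m n} {f : ℕ → ℚ} → m ℕ.≤ n → (∀ i → i ℕ.< n → 0ℚ ≤ f i) → sumTo m f ≤ sumTo n f
sumTo-extend {m} {n} {f} m≤n 0≤f = subst (λ z → sumTo m f ≤ sumTo z f) (ℕ.m+[n∸m]≡n m≤n)
  (subst (sumTo m f ≤_) (sym (sumTo-++ m (n ℕ.∸ m) f))
    (≤-+ʳ (sumTo-nonneg (n ℕ.∸ m) λ i i< →
      0≤f (m ℕ.+ i) (subst (m ℕ.+ i ℕ.<_) (ℕ.m+[n∸m]≡n m≤n) (ℕ.+-monoʳ-< m i<)))))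

sumTo-swap : ∀ m n (f : ℕ → ℕ → ℚ) →
  sumTo m (λ i → sumTo n (f i)) ≡ sumTo n (λ j → sumTo m (λ i → f i j))
sumTo-swap zero    n f = sym (sumTo-0 n)
sumTo-swap (suc m) n f = trans (cong (_+ sumTo n (f m)) (sumTo-swap m n f)) (sym (sumTo-+ n _ _))

sumFin-cong : ∀ k {f g : Fin k → ℚ} → (∀ c → f c ≡ g c) → sumFin k f ≡ sumFin k g
sumFin-cong zero    f≡g = refl
sumFin-cong (suc k) f≡g = cong₂ _+_ (f≡g zero) (sumFin-cong k (f≡g ∘ suc))

sumFin-mono : ∀ k {f g : Fin k → ℚ} → (∀ c → f c ≤ g c) → sumFin k f ≤ sumFin k g
sumFin-mono zero    f≤g = ≤-refl
sumFin-mono (suc k) f≤g = +-mono-≤ (f≤g zero) (sumFin-mono k (f≤g ∘ suc))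

sumFin-0 : ∀ k → sumFin k (λ _ → 0ℚ) ≡ 0ℚ
sumFin-0 zero    = refl
sumFin-0 (suc k) = trans (+-identityˡ _) (sumFin-0 k)

sumFin-nonneg : ∀ k {f : Fin k → ℚ} → (∀ c → 0ℚ ≤ f c) → 0ℚ ≤ sumFin k f
sumFin-nonneg k {f} 0≤f = subst (_≤ sumFin k f) (sumFin-0 k) (sumFin-mono k 0≤f)

sumFin-+ : ∀ k (f g : Fin k → ℚ) → sumFin k (λ c → f c + g c) ≡ sumFin k f + sumFin k g
sumFin-+ zero    f g = refl
sumFin-+ (suc k) f g = trans (cong (_+_ (f zero + g zero)) (sumFin-+ k (f ∘ suc) (g ∘ suc)))
  (+-interchange (f zero) (g zero) (sumFin k (f ∘ suc)) (sumFin k (g ∘ suc)))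

sumFin-*ʳ : ∀ k a (f : Fin k → ℚ) → sumFin k (λ c → f c * a) ≡ sumFin k f * a
sumFin-*ʳ zero    a f = sym (*-zeroˡ a)
sumFin-*ʳ (suc k) a f = trans (cong (_+_ (f zero * a)) (sumFin-*ʳ k a (f ∘ suc))) (sym (*-distribʳ-+ a (f zero) (sumFin k (f ∘ suc))))

sumFin-term : ∀ k {f : Fin k → ℚ} → (∀ c → 0ℚ ≤ f c) → ∀ c → f c ≤ sumFin k f
sumFin-term (suc k) 0≤f zero    = ≤-+ʳ (sumFin-nonneg k (0≤f ∘ suc))
sumFin-term (suc k) 0≤f (suc c) = ≤-trans (sumFin-term k (0≤f ∘ suc) c) (≤-+ˡ (0≤f zero))

sumFin-sumTo-swap : ∀ k n (f : Fin k → ℕ → ℚ) →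
  sumFin k (λ c → sumTo n (f c)) ≡ sumTo n (λ i → sumFin k (λ c → f c i))
sumFin-sumTo-swap k zero    f = sumFin-0 k
sumFin-sumTo-swap k (suc n) f =
  trans (sumFin-+ k _ _) (cong (_+ sumFin k (λ c → f c n)) (sumFin-sumTo-swap k n f))

-- Finite maxima and conditional terms

maxTo : ℕ → (ℕ → ℕ) → ℕ
maxTo zero    f = 0
maxTo (suc n) f = maxTo n f ℕ.⊔ f n

≤-maxTo : ∀ {n} f i → i ℕ.< n → f i ℕ.≤ maxTo n f
≤-maxTo {suc n} f i (s≤s i≤n) with ℕ.m≤n⇒m<n∨m≡n i≤n
... | inj₁ i<n  = ℕ.≤-trans (≤-maxTo f i i<n) (ℕ.m≤m⊔n _ _)
... | inj₂ refl = ℕ.m≤n⊔m (maxTo n f) (f n)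

maxFin : ∀ k → (Fin k → ℕ) → ℕ
maxFin zero    f = 0
maxFin (suc k) f = f zero ℕ.⊔ maxFin k (f ∘ suc)

≤-maxFin : ∀ {k} f (c : Fin k) → f c ℕ.≤ maxFin k f
≤-maxFin f zero    = ℕ.m≤m⊔n _ _
≤-maxFin f (suc c) = ℕ.≤-trans (≤-maxFin (f ∘ suc) c) (ℕ.m≤n⊔m (f zero) _)

when : ∀ {P : Set} → Dec P → ℚ → ℚ
when (yes _) x = x
when (no  _) x = 0ℚ

when-yes : ∀ {P : Set} (d : Dec P) {x} → P → when d x ≡ x
when-yes (yes _) _ = refl
when-yes (no ¬p) p = contradiction p ¬p

when-no : ∀ {P : Set} (d : Dec P) {x} → ¬ P → when d x ≡ 0ℚ
when-no (yes p) ¬p = contradiction p ¬p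
when-no (no _)  _  = refl

when-nonneg : ∀ {P : Set} (d : Dec P) {x} → 0ℚ ≤ x → 0ℚ ≤ when d x
when-nonneg (yes _) 0≤x = 0≤x
when-nonneg (no _)  _   = ≤-refl

when-mono : ∀ {P Q : Set} (d : Dec P) (e : Dec Q) {x} → 0ℚ ≤ x → (P → Q) → when d x ≤ when e x
when-mono (yes p) (yes _) _   _   = ≤-refl
when-mono (yes p) (no ¬q) _   p⇒q = contradiction (p⇒q p) ¬q
when-mono (no _)  e       0≤x _   = when-nonneg e 0≤x

when-* : ∀ {P : Set} (d : Dec P) x y → x * when d y ≡ when d x * y
when-* (yes _) x y = refl
when-* (no _)  x y = trans (*-zeroʳ x) (sym (*-zeroˡ y))

-- Competitiveness

module JobSum (I : Instance) where
  open Instance I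

  jobSum : (Fin k → ℕ → ℚ) → ℚ
  jobSum f = sumFin k (λ c → sumTo (len c) (f c))

  jobSum-mono : ∀ {f g} → (∀ c i → i ℕ.< len c → f c i ≤ g c i) → jobSum f ≤ jobSum g
  jobSum-mono f≤g = sumFin-mono k λ c → sumTo-mono (len c) (f≤g c)

  jobSum-+ : ∀ f g → jobSum (λ c i → f c i + g c i) ≡ jobSum f + jobSum g
  jobSum-+ f g = trans (sumFin-cong k λ c → sumTo-+ (len c) (f c) (g c)) (sumFin-+ k _ _)

  jobSum-*ʳ : ∀ a f → jobSum (λ c i → f c i * a) ≡ jobSum f * a
  jobSum-*ʳ a f = trans (sumFin-cong k λ c → sumTo-*ʳ (len c) a (f c)) (sumFin-*ʳ k a _)

  jobSum-swap : ∀ n (f : ℕ → Fin k → ℕ → ℚ) →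
    jobSum (λ c i → sumTo n (λ t → f t c i)) ≡ sumTo n (λ t → jobSum (f t))
  jobSum-swap n f = trans (sumFin-cong k λ c → sumTo-swap (len c) n _) (sumFin-sumTo-swap k n _)

module Weights {I : Instance} (A : Schedule I) where
  open Instance I
  open Schedule A

  aliveW : ℕ → Fin k → ℕ → ℚ
  aliveW t c i = when (t ℕ.≤? comp c i) (w c i)

  -- The left-hand side of remW-term is the local function if? of remW, which
  -- has no name outside Defs; the body of remW≡ determines the placeholder.
  remW≡ : ∀ c t → remW A c t ≡ sumTo (len c) (aliveW t c)
  remW-term : ∀ c t i → _ ≡ aliveW t c i
  remW≡ c t = sumTo-cong (len c) (remW-term c t)
  remW-term c t i with t ℕ.≤? comp c i
  ... | yes _ = refl
  ... | no  _ = refl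

  aliveW-nonneg : ∀ t c i → i ℕ.< len c → 0ℚ ≤ aliveW t c i
  aliveW-nonneg t c i i<n = when-nonneg (t ℕ.≤? comp c i) (w-nonneg c i i<n)

  remW-nonneg : ∀ c t → 0ℚ ≤ remW A c t
  remW-nonneg c t = subst (0ℚ ≤_) (sym (remW≡ c t)) (sumTo-nonneg (len c) (aliveW-nonneg t c))

  totW-nonneg : ∀ t → 0ℚ ≤ totW A t
  totW-nonneg t = sumFin-nonneg k λ c → remW-nonneg c t

  remW≤totW : ∀ c t → remW A c t ≤ totW A t
  remW≤totW c t = sumFin-term k (λ c → remW-nonneg c t) c

module FeasibleProperties {I : Instance} {A : Schedule I} (F : Feasible A) where
  open Instance I
  open Schedule A
  open Feasible F

  comp-mono : ∀ c {i j} → i ℕ.≤ j → j ℕ.< len c → comp c i ℕ.≤ comp c j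
  comp-mono c {i} {j} i≤j j<n with ℕ.m≤n⇒m<n∨m≡n i≤j
  ... | inj₂ refl = ℕ.≤-refl
  comp-mono c {i} {suc j} i≤j j<n | inj₁ (s≤s i≤j′) =
    ℕ.≤-trans (comp-mono c i≤j′ (ℕ.<-trans (ℕ.n<1+n j) j<n)) (comp-after c (suc j) j<n)

  comp≤release : ∀ c {i j} → i ℕ.< j → j ℕ.< len c → comp c i ℕ.≤ release A c j
  comp≤release c {j = suc j} (s≤s i≤j) j<n = comp-mono c i≤j (ℕ.<-trans (ℕ.n<1+n j) j<n)

  processed-nonneg : ∀ c i t → i ℕ.< len c → 0ℚ ≤ processed A c i t
  processed-nonneg c i t i<n = sumTo-nonneg (suc t) λ t′ _ → rate-nonneg t′ c i i<n

  -- By `precedence` all rates up to the release are zero. With the next lemma, whether a job takes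
  -- any time does not depend on the feasible schedule; `growth-charge` compares two schedules in
  -- this way.
  instantaneous⇒p≤0 : ∀ c i → i ℕ.< len c → comp c i ℕ.≤ release A c i → p c i ≤ 0ℚ
  instantaneous⇒p≤0 c i i<n C≤r = begin
    p c i                        ≤⟨ comp-done c i i<n ⟩
    processed A c i (comp c i)   ≤⟨ sumTo-mono (suc (comp c i)) (λ t t<C → ≤-reflexive
                                      (precedence t c i i<n (ℕ.≤-trans (ℕ.≤-pred t<C) C≤r))) ⟩
    sumTo (suc (comp c i)) (λ _ → 0ℚ) ≡⟨ sumTo-0 (suc (comp c i)) ⟩
    0ℚ                           ∎

  -- Otherwise `comp-first`, applied at the release time itself, would give `0 ≤ processed < p`.
  p≤0⇒instantaneous : ∀ c i → i ℕ.< len c → p c i ≤ 0ℚ → comp c i ℕ.≤ release A c i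
  p≤0⇒instantaneous c i i<n p≤0 = ℕ.≮⇒≥ λ r<C → <-irrefl refl (begin-strict
    0ℚ                              ≤⟨ processed-nonneg c i (release A c i) i<n ⟩
    processed A c i (release A c i) <⟨ comp-first c i i<n (release A c i) ℕ.≤-refl r<C ⟩
    p c i                           ≤⟨ p≤0 ⟩
    0ℚ                              ∎)

module Competitive {I : Instance} (A : Schedule I) (FA : Feasible A) (alg : FollowsAlg A)
                   (S : Schedule I) (FS : Feasible S) where
  open Instance I
  open JobSum I
  open Weights A
  module A = Schedule A
  module S = Schedule S
  module FA where
    open Feasible FA public
    open FeasibleProperties FA public
  module FS where
    open Feasible FS public
    open FeasibleProperties FS public

  totW-antitone : ∀ {s t} → s ℕ.≤ t → totW A t ≤ totW A s
  totW-antitone {s} {t} s≤t = begin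
    totW A t          ≡⟨ sumFin-cong k (λ c → remW≡ c t) ⟩
    jobSum (aliveW t) ≤⟨ jobSum-mono (λ c i i<n → when-mono (t ℕ.≤? A.comp c i) (s ℕ.≤? A.comp c i)
                           (w-nonneg c i i<n) (ℕ.≤-trans s≤t)) ⟩
    jobSum (aliveW s) ≡⟨ sumFin-cong k (λ c → remW≡ c s) ⟨
    totW A s          ∎

  -- The sum runs over the whole chain with the condition inside, so that it compares termwise with
  -- `aliveW` and the double sum in `weighted-lag≤` ranges over a square.
  tail : Fin k → ℕ → ℚ
  tail c i = sumTo (len c) (λ j → when (i ℕ.≤? j) (w c j))

  -- In these slots job `i` is the front job and all its successors are alive, so the remaining
  -- weight of the chain, which is rate times `totW`, contains the whole tail.
  tail≤rate*totW : ∀ c i t → i ℕ.< len c → release A c i ℕ.< t → t ℕ.≤ A.comp c i →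
    tail c i ≤ A.rate t c i * totW A t
  tail≤rate*totW c i t i<n r<t t≤C = ≤-trans tail≤remW remW≤
    where
    tail≤remW : tail c i ≤ remW A c t
    tail≤remW = subst (tail c i ≤_) (sym (remW≡ c t)) (sumTo-mono (len c) λ j j<n →
      when-mono (i ℕ.≤? j) (t ℕ.≤? A.comp c j) (w-nonneg c j j<n)
        λ i≤j → ℕ.≤-trans t≤C (FA.comp-mono c i≤j j<n))
    isFront : IsFront A c i t
    isFront = i<n , t≤C , λ i′ i′<i → ℕ.≤-<-trans (FA.comp≤release c i′<i i<n) r<t
    remW≤ : remW A c t ≤ A.rate t c i * totW A t
    remW≤ with 0ℚ <? totW A t
    ... | yes pos = ≤-reflexive (sym (trans
            (cong (_* totW A t) (proj₁ (alg t (ℕ.≤-trans (s≤s z≤n) r<t) pos c i i<n) isFront))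
            (÷-*-cancel (remW A c t) (totW A t) {{>-nonZero pos}})))
    -- Here the algorithm prescribes no rates, but no weight is left in the chain either.
    ... | no ¬pos = begin
      remW A c t                 ≤⟨ remW≤totW c t ⟩
      totW A t                   ≤⟨ ≮⇒≥ ¬pos ⟩
      0ℚ                         ≤⟨ *-nonneg (FA.rate-nonneg t c i i<n) (totW-nonneg t) ⟩
      A.rate t c i * totW A t    ∎

  -- Truncated subtraction takes positive parts. `lagBefore c (suc i)` unfolds to `lag c i`, and
  -- `lagBefore c 0` is 0, which makes the growths telescope.
  lag lagBefore lagGrowth : Fin k → ℕ → ℕ
  lag       c i = A.comp c i ℕ.∸ S.comp c i ℕ.* 2
  lagBefore c i = release A c i ℕ.∸ release S c i ℕ.* 2
  lagGrowth c i = lag c i ℕ.∸ lagBefore c i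

  growth-charge : ∀ c i → i ℕ.< len c →
    tail c i * toℚ (lagGrowth c i) ≤ p c i * totW A (S.comp c i ℕ.* 2)
  growth-charge c i i<n with lagGrowth c i in eq
  ... | zero  = ≤-trans (≤-reflexive (*-zeroʳ (tail c i)))
                  (*-nonneg (p-nonneg c i i<n) (totW-nonneg (S.comp c i ℕ.* 2)))
  ... | suc n = begin
    tail c i * toℚ (suc n)                         ≡⟨ sumTo-const (suc n) (tail c i) ⟨
    sumTo (suc n) (λ _ → tail c i)                 ≤⟨ sumTo-mono (suc n) window ⟩
    sumTo (suc n) (λ u → A.rate (t₀ ℕ.+ u) c i * V) ≡⟨ sumTo-*ʳ (suc n) V (λ u → A.rate (t₀ ℕ.+ u) c i) ⟩
    sumTo (suc n) (λ u → A.rate (t₀ ℕ.+ u) c i) * V ≤⟨ *-monoʳ-≤ (totW-nonneg (b* ℕ.* 2)) work≤p ⟩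
    p c i * V                                      ∎
    where
    a b a* b* t₀ : ℕ
    a  = release A c i
    b  = A.comp c i
    a* = release S c i
    b* = S.comp c i
    -- The window consists of the `suc n` slots `t₀, …, b − 1`. Slot `b` is left out because the
    -- work up to and including it may exceed `p c i`.
    t₀ = b ℕ.∸ suc n
    V : ℚ
    V = totW A (b* ℕ.* 2)
    a*<b* : a* ℕ.< b*
    -- If the competing schedule spends no time on the job, then `p c i ≤ 0`, so the algorithm
    -- spends none either and the lag cannot grow.
    a*<b* = ℕ.≰⇒> λ b*≤a* → ℕ.1+n≢0 (trans (sym eq) (ℕ.m≤n⇒m∸n≡0
      (ℕ.∸-mono (FA.p≤0⇒instantaneous c i i<n (FS.instantaneous⇒p≤0 c i i<n b*≤a*))
                (ℕ.*-monoˡ-≤ 2 (FS.comp-after c i i<n)))))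
    win : (b* ℕ.* 2 ℕ.+ suc n ℕ.≤ b) × (a ℕ.+ suc n ℕ.< b)
    win = lag-window a*<b* n (sym eq)
    t₀+ : t₀ ℕ.+ suc n ≡ b
    t₀+ = ℕ.m∸n+n≡m (ℕ.≤-trans (ℕ.m≤n+m (suc n) (b* ℕ.* 2)) (proj₁ win))
    2b*≤t₀ : b* ℕ.* 2 ℕ.≤ t₀
    2b*≤t₀ = ℕ.+-cancelʳ-≤ (suc n) _ _ (subst (b* ℕ.* 2 ℕ.+ suc n ℕ.≤_) (sym t₀+) (proj₁ win))
    a<t₀ : a ℕ.< t₀
    a<t₀ = ℕ.+-cancelʳ-< (suc n) _ _ (subst (a ℕ.+ suc n ℕ.<_) (sym t₀+) (proj₂ win))
    window : ∀ u → u ℕ.< suc n → tail c i ≤ A.rate (t₀ ℕ.+ u) c i * V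
    window u u<n = ≤-trans
      (tail≤rate*totW c i (t₀ ℕ.+ u) i<n (ℕ.<-≤-trans a<t₀ (ℕ.m≤m+n t₀ u))
        (subst (t₀ ℕ.+ u ℕ.≤_) t₀+ (ℕ.+-monoʳ-≤ t₀ (ℕ.<⇒≤ u<n))))
      (*-monoˡ-≤ (FA.rate-nonneg (t₀ ℕ.+ u) c i i<n)
        (totW-antitone (ℕ.≤-trans 2b*≤t₀ (ℕ.m≤m+n t₀ u))))
    b≡ : suc (t₀ ℕ.+ n) ≡ b
    b≡ = trans (sym (ℕ.+-suc t₀ n)) t₀+
    work≤p : sumTo (suc n) (λ u → A.rate (t₀ ℕ.+ u) c i) ≤ p c i
    work≤p = begin
      sumTo (suc n) (λ u → A.rate (t₀ ℕ.+ u) c i)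
        -- The work before the window is added, to obtain all the work up to slot `b − 1`, which
        -- `comp-first` keeps below `p c i`.
        ≤⟨ ≤-+ˡ (sumTo-nonneg t₀ λ t _ → FA.rate-nonneg t c i i<n) ⟩
      sumTo t₀ (λ t → A.rate t c i) + sumTo (suc n) (λ u → A.rate (t₀ ℕ.+ u) c i)
        ≡⟨ sumTo-++ t₀ (suc n) (λ t → A.rate t c i) ⟨
      sumTo (t₀ ℕ.+ suc n) (λ t → A.rate t c i)
        ≡⟨ cong (λ z → sumTo z (λ t → A.rate t c i)) (ℕ.+-suc t₀ n) ⟩
      processed A c i (t₀ ℕ.+ n)
        ≤⟨ <⇒≤ (FA.comp-first c i i<n (t₀ ℕ.+ n)
             (ℕ.≤-trans (ℕ.<⇒≤ a<t₀) (ℕ.m≤m+n t₀ n)) (subst (t₀ ℕ.+ n ℕ.<_) b≡ (ℕ.n<1+n _))) ⟩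
      p c i ∎

  -- Telescoping along the chain, by recursion through `before`. Only an inequality holds, because
  -- decreases of the lag count as zero growth.
  lag≤ : ∀ c i → toℚ (lag c i) ≤ sumTo (suc i) (λ j → toℚ (lagGrowth c j))
  lag≤ c i = begin
    toℚ (lag c i)                              ≤⟨ toℚ-mono (ℕ.m≤n+m∸n (lag c i) (lagBefore c i)) ⟩
    toℚ (lagBefore c i ℕ.+ lagGrowth c i)      ≡⟨ toℚ-+ (lagBefore c i) (lagGrowth c i) ⟩
    toℚ (lagBefore c i) + toℚ (lagGrowth c i)  ≤⟨ +-monoˡ-≤ (toℚ (lagGrowth c i)) (before i) ⟩
    sumTo (suc i) (λ j → toℚ (lagGrowth c j))  ∎
    where
    before : ∀ i → toℚ (lagBefore c i) ≤ sumTo i (λ j → toℚ (lagGrowth c j))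
    before zero    = ≤-refl
    before (suc i) = lag≤ c i

  -- Summation by parts: both sides are compared with the double sum of `w c i * g j` over pairs
  -- `j ≤ i`, and exchanging the sums collects the weights behind `j` into `tail c j`.
  weighted-lag≤ : ∀ c → sumTo (len c) (λ i → w c i * toℚ (lag c i)) ≤
                        sumTo (len c) (λ i → tail c i * toℚ (lagGrowth c i))
  weighted-lag≤ c = begin
    sumTo n (λ i → w c i * toℚ (lag c i))                ≤⟨ sumTo-mono n step ⟩
    sumTo n (λ i → sumTo n (λ j → term j i * g j))       ≡⟨ sumTo-swap n n (λ i j → term j i * g j) ⟩
    sumTo n (λ j → sumTo n (λ i → term j i * g j))       ≡⟨ sumTo-cong n (λ j → sumTo-*ʳ n (g j) (term j)) ⟩
    sumTo n (λ j → tail c j * g j)                       ∎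
    where
    n : ℕ
    n = len c
    g : ℕ → ℚ
    g j = toℚ (lagGrowth c j)
    term : ℕ → ℕ → ℚ
    term j i = when (j ℕ.≤? i) (w c i)
    step : ∀ i → i ℕ.< n → w c i * toℚ (lag c i) ≤ sumTo n (λ j → term j i * g j)
    step i i<n = begin
      w c i * toℚ (lag c i)                          ≤⟨ *-monoˡ-≤ (w-nonneg c i i<n) (lag≤ c i) ⟩
      w c i * sumTo (suc i) g                        ≤⟨ *-monoˡ-≤ (w-nonneg c i i<n) (sumTo-mono (suc i)
          λ j j≤i → ≤-reflexive (sym (when-yes (j ℕ.≤? i) (ℕ.≤-pred j≤i)))) ⟩
      -- Padding with zero terms up to `n` makes the range of `j` independent of `i`, as the
      -- exchange requires.
      w c i * sumTo (suc i) (λ j → when (j ℕ.≤? i) (g j)) ≤⟨ *-monoˡ-≤ (w-nonneg c i i<n) (sumTo-extend i<n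
          λ j _ → when-nonneg (j ℕ.≤? i) (toℚ-nonneg (lagGrowth c j))) ⟩
      w c i * sumTo n (λ j → when (j ℕ.≤? i) (g j))  ≡⟨ sumTo-*ˡ n (w c i) (λ j → when (j ℕ.≤? i) (g j)) ⟨
      sumTo n (λ j → w c i * when (j ℕ.≤? i) (g j))  ≡⟨ sumTo-cong n (λ j → when-* (j ℕ.≤? i) (w c i) (g j)) ⟩
      sumTo n (λ j → term j i * g j)                 ∎

  -- Charging the slots of the competing schedule

  horizon : ℕ
  horizon = maxFin k (λ c → maxTo (len c) (S.comp c))

  comp≤horizon : ∀ c i → i ℕ.< len c → S.comp c i ℕ.≤ horizon
  comp≤horizon c i i<n = ℕ.≤-trans (≤-maxTo (S.comp c) i i<n) (≤-maxFin (λ c → maxTo (len c) (S.comp c)) c)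

  -- Slot 0 must count as 0: a positive value there would already break `even-slots` at `T = 0`.
  slotW : ℕ → ℚ
  slotW zero    = 0ℚ
  slotW (suc t) = totW A (suc t)

  -- The competing schedule does at least `p c i` units of work on the job in slots `s ≤ C`, where
  -- `totW A (s * 2)` is at least `totW A (C * 2)`. After exchanging the sums, the capacity bounds
  -- the charge to each slot.
  total-charge : jobSum (λ c i → p c i * totW A (S.comp c i ℕ.* 2)) ≤
                 sumTo (suc horizon) (λ s → slotW (s ℕ.* 2))
  total-charge = begin
    jobSum (λ c i → p c i * totW A (S.comp c i ℕ.* 2))  ≤⟨ jobSum-mono job ⟩
    jobSum (λ c i → sumTo (suc horizon) (λ s → S.rate s c i * totW A (s ℕ.* 2)))
      ≡⟨ jobSum-swap (suc horizon) (λ s c i → S.rate s c i * totW A (s ℕ.* 2)) ⟩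
    sumTo (suc horizon) (λ s → jobSum (λ c i → S.rate s c i * totW A (s ℕ.* 2)))
      ≤⟨ sumTo-mono (suc horizon) (λ s _ → slot s) ⟩
    sumTo (suc horizon) (λ s → slotW (s ℕ.* 2)) ∎
    where
    job : ∀ c i → i ℕ.< len c → p c i * totW A (S.comp c i ℕ.* 2) ≤
          sumTo (suc horizon) (λ s → S.rate s c i * totW A (s ℕ.* 2))
    job c i i<n = begin
      p c i * totW A (C ℕ.* 2)                                  ≤⟨ *-monoʳ-≤ (totW-nonneg (C ℕ.* 2)) (FS.comp-done c i i<n) ⟩
      processed S c i C * totW A (C ℕ.* 2)                      ≡⟨ sumTo-*ʳ (suc C) (totW A (C ℕ.* 2)) (λ s → S.rate s c i) ⟨
      sumTo (suc C) (λ s → S.rate s c i * totW A (C ℕ.* 2))     ≤⟨ sumTo-mono (suc C) (λ s s≤C →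
          *-monoˡ-≤ (FS.rate-nonneg s c i i<n) (totW-antitone (ℕ.*-monoˡ-≤ 2 (ℕ.≤-pred s≤C)))) ⟩
      sumTo (suc C) (λ s → S.rate s c i * totW A (s ℕ.* 2))     ≤⟨ sumTo-extend (s≤s (comp≤horizon c i i<n))
          (λ s _ → *-nonneg (FS.rate-nonneg s c i i<n) (totW-nonneg (s ℕ.* 2))) ⟩
      sumTo (suc horizon) (λ s → S.rate s c i * totW A (s ℕ.* 2)) ∎
      where
      C : ℕ
      C = S.comp c i
    slot : ∀ s → jobSum (λ c i → S.rate s c i * totW A (s ℕ.* 2)) ≤ slotW (s ℕ.* 2)
    slot zero = begin
      jobSum (λ c i → S.rate 0 c i * totW A 0)  ≤⟨ jobSum-mono (λ c i i<n → ≤-reflexive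
          (trans (cong (_* totW A 0) (FS.precedence 0 c i i<n z≤n)) (*-zeroˡ (totW A 0)))) ⟩
      jobSum (λ _ _ → 0ℚ)                       ≡⟨ sumFin-cong k (λ c → sumTo-0 (len c)) ⟩
      sumFin k (λ _ → 0ℚ)                       ≡⟨ sumFin-0 k ⟩
      0ℚ                                        ∎
    slot (suc s) = begin
      jobSum (λ c i → S.rate (suc s) c i * V)   ≡⟨ jobSum-*ʳ V (S.rate (suc s)) ⟩
      jobSum (S.rate (suc s)) * V               ≤⟨ *-monoʳ-≤ (totW-nonneg (suc s ℕ.* 2)) (FS.capacity (suc s)) ⟩
      1ℚ * V                                    ≡⟨ *-identityˡ V ⟩
      V                                         ∎
      where
      V : ℚ
      V = totW A (suc s ℕ.* 2)

  -- Each even slot from 2 on is paired with the odd slot just before it, which carries at least as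
  -- much weight.
  even-slots : ∀ T → sumTo (suc T) (λ s → slotW (s ℕ.* 2)) + sumTo (suc T) (λ s → slotW (s ℕ.* 2)) ≤
                     sumTo (suc (T ℕ.* 2)) slotW
  even-slots zero    = ≤-refl
  even-slots (suc T) = begin
    (X + v) + (X + v)                            ≡⟨ +-interchange X v X v ⟩
    (X + X) + (v + v)                            ≤⟨ +-mono-≤ (even-slots T) (+-monoˡ-≤ v (totW-antitone (ℕ.n≤1+n _))) ⟩
    Y + (u + v)                                  ≡⟨ +-assoc Y u v ⟨
    Y + u + v                                    ∎
    where
    X Y u v : ℚ
    X = sumTo (suc T) (λ s → slotW (s ℕ.* 2))
    Y = sumTo (suc (T ℕ.* 2)) slotW
    u = totW A (suc (T ℕ.* 2))
    v = totW A (suc (suc (T ℕ.* 2)))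

  -- After exchanging the sums, a job contributes its weight once for each slot among `1, …, n` in
  -- which it is alive, that is `n ⊓ comp` times.
  slots≤cost : ∀ n → sumTo (suc n) slotW ≤ cost A
  slots≤cost n = begin
    sumTo (suc n) slotW                                       ≡⟨ shift n ⟩
    sumTo n (λ t → totW A (suc t))                            ≡⟨ sumTo-cong n (λ t → sumFin-cong k λ c → remW≡ c (suc t)) ⟩
    sumTo n (λ t → jobSum (aliveW (suc t)))                   ≡⟨ jobSum-swap n (λ t → aliveW (suc t)) ⟨
    jobSum (λ c i → sumTo n (λ t → aliveW (suc t) c i))       ≤⟨ jobSum-mono (λ c i i<n →
        ≤-trans (≤-reflexive (life c i n)) (*-monoˡ-≤ (w-nonneg c i i<n) (toℚ-mono (ℕ.m⊓n≤n n (A.comp c i))))) ⟩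
    cost A                                                    ∎
    where
    shift : ∀ n → sumTo (suc n) slotW ≡ sumTo n (λ t → totW A (suc t))
    shift zero    = refl
    shift (suc n) = cong (_+ totW A (suc n)) (shift n)
    life : ∀ c i n → sumTo n (λ t → aliveW (suc t) c i) ≡ w c i * toℚ (n ℕ.⊓ A.comp c i)
    life c i zero = sym (*-zeroʳ (w c i))
    life c i (suc n) with suc n ℕ.≤? A.comp c i
    ... | yes n<C rewrite ℕ.m≤n⇒m⊓n≡m n<C =
      trans (cong (_+ w c i) (trans (life c i n) (cong (λ z → w c i * toℚ z) (ℕ.m≤n⇒m⊓n≡m (ℕ.<⇒≤ n<C)))))
            (sym (*-toℚ-suc (w c i) n))
    ... | no  n≮C = trans (+-identityʳ _) (trans (life c i n) (cong (λ z → w c i * toℚ z)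
            (trans (ℕ.m≥n⇒m⊓n≡n C≤n) (sym (ℕ.m≥n⇒m⊓n≡n (ℕ.m≤n⇒m≤1+n C≤n))))))
      where
      C≤n : A.comp c i ℕ.≤ n
      C≤n = ℕ.≤-pred (ℕ.≰⇒> n≮C)

  costA≤ : cost A ≤ (cost S + cost S) + jobSum (λ c i → w c i * toℚ (lag c i))
  costA≤ = begin
    cost A                                                                ≤⟨ jobSum-mono job ⟩
    jobSum (λ c i → (s c i + s c i) + ℓ c i)                              ≡⟨ jobSum-+ (λ c i → s c i + s c i) ℓ ⟩
    jobSum (λ c i → s c i + s c i) + jobSum ℓ                             ≡⟨ cong (_+ jobSum ℓ) (jobSum-+ s s) ⟩
    (cost S + cost S) + jobSum ℓ                                          ∎
    where
    s ℓ : Fin k → ℕ → ℚ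
    s c i = w c i * toℚ (S.comp c i)
    ℓ c i = w c i * toℚ (lag c i)
    job : ∀ c i → i ℕ.< len c → w c i * toℚ (A.comp c i) ≤ (s c i + s c i) + ℓ c i
    job c i i<n = begin
      w c i * toℚ (A.comp c i)            ≤⟨ *-monoˡ-≤ (w-nonneg c i i<n) (toℚ-mono (ℕ.m≤n+m∸n (A.comp c i) (C ℕ.* 2))) ⟩
      w c i * toℚ (C ℕ.* 2 ℕ.+ lag c i)   ≡⟨ cong (w c i *_) (toℚ-+ (C ℕ.* 2) (lag c i)) ⟩
      w c i * (toℚ (C ℕ.* 2) + x)         ≡⟨ cong (λ z → w c i * (toℚ z + x)) (trans (ℕ.*-comm C 2) (cong (C ℕ.+_) (ℕ.+-identityʳ C))) ⟩
      w c i * (toℚ (C ℕ.+ C) + x)         ≡⟨ cong (λ z → w c i * (z + x)) (toℚ-+ C C) ⟩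
      w c i * ((toℚ C + toℚ C) + x)       ≡⟨ solve 3 (λ w c x → w :* ((c :+ c) :+ x) := (w :* c :+ w :* c) :+ w :* x) refl (w c i) (toℚ C) x ⟩
      (s c i + s c i) + ℓ c i             ∎
      where
      open +-*-Solver
      C : ℕ
      C = S.comp c i
      x : ℚ
      x = toℚ (lag c i)

  4-competitive : cost A ≤ (+ 4 / 1) * cost S
  -- Doubling `cost A ≤ 2 cost S + Q` lets `Q + Q ≤ cost A` enter without halves; the extra `cost A`
  -- is then cancelled.
  4-competitive = +-cancelʳ-≤ (cost A) (begin
    cost A + cost A                                ≤⟨ +-mono-≤ costA≤Q costA≤Q ⟩
    (cost S + cost S + Q) + (cost S + cost S + Q)  ≡⟨ +-interchange (cost S + cost S) Q (cost S + cost S) Q ⟩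
    (cost S + cost S + (cost S + cost S)) + (Q + Q) ≤⟨ +-monoʳ-≤ (cost S + cost S + (cost S + cost S))
                                                        (≤-trans (even-slots horizon) (slots≤cost (horizon ℕ.* 2))) ⟩
    (cost S + cost S + (cost S + cost S)) + cost A ≡⟨ cong (_+ cost A) (4*≡ (cost S)) ⟨
    (+ 4 / 1) * cost S + cost A                    ∎)
    where
    Q : ℚ
    Q = sumTo (suc horizon) (λ s → slotW (s ℕ.* 2))
    costA≤Q : cost A ≤ (cost S + cost S) + Q
    costA≤Q = ≤-trans costA≤ (+-monoʳ-≤ (cost S + cost S) (begin
      jobSum (λ c i → w c i * toℚ (lag c i))              ≤⟨ sumFin-mono k weighted-lag≤ ⟩
      jobSum (λ c i → tail c i * toℚ (lagGrowth c i))     ≤⟨ jobSum-mono growth-charge ⟩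
      jobSum (λ c i → p c i * totW A (S.comp c i ℕ.* 2))  ≤⟨ total-charge ⟩
      Q                                                   ∎))
    4*≡ : ∀ x → (+ 4 / 1) * x ≡ x + x + (x + x)
    4*≡ = solve 1 (λ x → con (+ 4 / 1) :* x := x :+ x :+ (x :+ x)) refl
      where open +-*-Solver

-- Existence of a schedule following the algorithm

archimedean : ∀ s x → 0ℚ < s → ∃[ n ] x ≤ s * toℚ n
-- A rational is at most the absolute value of its numerator, since its denominator is at least 1;
-- this is applied to `x ÷ s`.
archimedean s x 0<s = ℤ.∣ ↥ y ∣ , (begin
  x                      ≡⟨ ÷-*-cancel x s ⟨
  y * s                  ≡⟨ *-comm y s ⟩
  s * y                  ≤⟨ *-monoˡ-≤ (<⇒≤ 0<s) (≤∣↥∣ y) ⟩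
  s * toℚ ℤ.∣ ↥ y ∣      ∎)
  where
  instance
    s≢0 : NonZero s
    s≢0 = >-nonZero 0<s
  y : ℚ
  y = x ÷ s
  i≤∣i∣*d : ∀ i d → i ℤ.≤ (+ ℤ.∣ i ∣) ℤ.* (+ suc d)
  i≤∣i∣*d (+ n)      d = subst (+ n ℤ.≤_) (ℤ.pos-* n (suc d)) (ℤ.+≤+ (ℕ.m≤m*n n (suc d)))
  i≤∣i∣*d ℤ.-[1+ n ] d = ℤ.-≤+
  ≤∣↥∣ : ∀ y → y ≤ toℚ ℤ.∣ ↥ y ∣
  ≤∣↥∣ (mkℚ i d c) = toℚᵘ-cancel-≤ (ℚᵘ.≤-trans
    (ℚᵘ.*≤* (subst (ℤ._≤ (+ ℤ.∣ i ∣) ℤ.* (+ suc d)) (sym (ℤ.*-identityʳ i)) (i≤∣i∣*d i d)))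
    (ℚᵘ.≤-reflexive (ℚᵘ.≃-sym (toℚᵘ-fromℚᵘ (ℚᵘ.mkℚᵘ (+ ℤ.∣ i ∣) 0)))))

-- The value at b ≤ 0 is junk.
inv : ℚ → ℚ
inv b with 0ℚ <? b
... | yes pos = (1/ b) {{>-nonZero pos}}
... | no  _   = 0ℚ

inv-pos : ∀ b → 0ℚ < b → 0ℚ < inv b
inv-pos b 0<b with 0ℚ <? b
... | yes pos = positive⁻¹ ((1/ b) {{>-nonZero pos}}) {{1/pos⇒pos b {{positive pos}}}}
... | no ¬pos = contradiction 0<b ¬pos

inv-nonneg : ∀ b → 0ℚ ≤ inv b
inv-nonneg b with 0ℚ <? b
... | yes pos = <⇒≤ (positive⁻¹ ((1/ b) {{>-nonZero pos}}) {{1/pos⇒pos b {{positive pos}}}})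
... | no  _   = ≤-refl

*-inv≤1 : ∀ b → b * inv b ≤ 1ℚ
*-inv≤1 b with 0ℚ <? b
... | yes pos = ≤-reflexive (*-inverseʳ b {{>-nonZero pos}})
... | no  _   = ≤-trans (≤-reflexive (*-zeroʳ b)) 0≤1

*-inv≡÷ : ∀ {a b a′ b′} → a ≡ a′ → b ≡ b′ → (pos : 0ℚ < b′) → a * inv b ≡ (a′ ÷ b′) {{>-nonZero pos}}
*-inv≡÷ {b = b} refl refl pos with 0ℚ <? b
... | yes _   = refl
... | no ¬pos = contradiction pos ¬pos

*-pos : ∀ {a b} → 0ℚ < a → 0ℚ < b → 0ℚ < a * b
*-pos {a} {b} 0<a 0<b = positive⁻¹ (a * b) {{pos*pos⇒pos a {{positive 0<a}} b {{positive 0<b}}}}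

sumFin-pos : ∀ k {f : Fin k → ℚ} → 0ℚ < sumFin k f → ∃[ c ] 0ℚ < f c
sumFin-pos zero    0<0 = contradiction 0<0 (<-irrefl refl)
sumFin-pos (suc k) {f} 0<Σ with 0ℚ <? f zero
... | yes 0<f = zero , 0<f
... | no  0≮f = let c , 0<fc = sumFin-pos k 0<rest in suc c , 0<fc
  where
  0<rest : 0ℚ < sumFin k (f ∘ suc)
  0<rest = <-≤-trans 0<Σ (≤-trans (+-monoˡ-≤ (sumFin k (f ∘ suc)) (≮⇒≥ 0≮f))
                                  (≤-reflexive (+-identityˡ (sumFin k (f ∘ suc)))))

sumTo-cong< : ∀ n {f g : ℕ → ℚ} → (∀ i → i ℕ.< n → f i ≡ g i) → sumTo n f ≡ sumTo n g
sumTo-cong< n f≡g = ≤-antisym (sumTo-mono n λ i i<n → ≤-reflexive (f≡g i i<n))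
                              (sumTo-mono n λ i i<n → ≤-reflexive (sym (f≡g i i<n)))

-- The index `a` may lie outside the range, as the front index of an exhausted chain does; the sum
-- is then 0.
sumTo-single≤ : ∀ n a {x} → 0ℚ ≤ x → sumTo n (λ i → when (i ℕ.≟ a) x) ≤ x
sumTo-single≤ zero    a     0≤x = 0≤x
sumTo-single≤ (suc n) a {x} 0≤x with n ℕ.≟ a
... | no  _    = ≤-trans (≤-reflexive (+-identityʳ _)) (sumTo-single≤ n a 0≤x)
... | yes refl = ≤-reflexive (trans (cong (_+ x) (trans
        (sumTo-cong< n λ i i<n → when-no (i ℕ.≟ n) (ℕ.<⇒≢ i<n)) (sumTo-0 n))) (+-identityˡ x))

when-iff : ∀ {P Q : Set} (d : Dec P) (e : Dec Q) {x} → (P → Q) → (Q → P) → when d x ≡ when e x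
when-iff (yes p) e p⇒q _   = sym (when-yes e (p⇒q p))
when-iff (no ¬p) e _   q⇒p = sym (when-no e (¬p ∘ q⇒p))

-- Sums and bounded search on natural numbers

sumℕ : ∀ k → (Fin k → ℕ) → ℕ
sumℕ zero    f = 0
sumℕ (suc k) f = f zero ℕ.+ sumℕ k (f ∘ suc)

sumℕ-mono : ∀ k {f g : Fin k → ℕ} → (∀ c → f c ℕ.≤ g c) → sumℕ k f ℕ.≤ sumℕ k g
sumℕ-mono zero    f≤g = z≤n
sumℕ-mono (suc k) f≤g = ℕ.+-mono-≤ (f≤g zero) (sumℕ-mono k (f≤g ∘ suc))

sumℕ-mono-< : ∀ k {f g : Fin k → ℕ} → (∀ c → f c ℕ.≤ g c) → ∀ c → f c ℕ.< g c → sumℕ k f ℕ.< sumℕ k g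
sumℕ-mono-< (suc k) f≤g zero    lt = ℕ.+-mono-<-≤ lt (sumℕ-mono k (f≤g ∘ suc))
sumℕ-mono-< (suc k) f≤g (suc c) lt = ℕ.+-mono-≤-< (f≤g zero) (sumℕ-mono-< k (f≤g ∘ suc) c lt)

-- first n Q? = n if no i < n satisfies Q.
first : ∀ (n : ℕ) {Q : ℕ → Set} → (∀ i → Dec (Q i)) → ℕ
first zero    Q? = 0
first (suc n) Q? with Q? 0
... | yes _ = 0
... | no  _ = suc (first n (Q? ∘ suc))

first≤ : ∀ (n : ℕ) {Q : ℕ → Set} (Q? : ∀ i → Dec (Q i)) → first n Q? ℕ.≤ n
first≤ zero    Q? = z≤n
first≤ (suc n) Q? with Q? 0
... | yes _ = z≤n
... | no  _ = s≤s (first≤ n (Q? ∘ suc))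

first-hit : ∀ (n : ℕ) {Q : ℕ → Set} (Q? : ∀ i → Dec (Q i)) → first n Q? ℕ.< n → Q (first n Q?)
first-hit (suc n) Q? lt with Q? 0
... | yes q = q
... | no  _ = first-hit n (Q? ∘ suc) (ℕ.≤-pred lt)

first-miss : ∀ (n : ℕ) {Q : ℕ → Set} (Q? : ∀ i → Dec (Q i)) {i} → i ℕ.< first n Q? → ¬ Q i
first-miss (suc n) Q? lt with Q? 0
first-miss (suc n) Q? {zero}  lt       | no ¬q = ¬q
first-miss (suc n) Q? {suc i} (s≤s lt) | no ¬q = first-miss n (Q? ∘ suc) lt

module Simulation (I : Instance) where
  open Instance I

  -- A state of the simulation is the vector `f` of front indices: the jobs below `f c` are
  -- finished, and `f c = len c` marks an exhausted chain.
  rem : (Fin k → ℕ) → Fin k → ℚ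
  rem f c = sumTo (len c) (λ i → when (f c ℕ.≤? i) (w c i))

  pending : (Fin k → ℕ) → Fin k → ℚ
  pending f c = when (f c ℕ.<? len c) 1ℚ

  -- Once no weight remains, all unfinished chains share the machine equally.
  score : (Fin k → ℕ) → Fin k → ℚ
  score f c = when (0ℚ <? sumFin k (rem f)) (rem f c) + when (sumFin k (rem f) ≤? 0ℚ) (pending f c)

  share : (Fin k → ℕ) → Fin k → ℚ
  share f c = score f c * inv (sumFin k (score f))

  rem-nonneg : ∀ f c → 0ℚ ≤ rem f c
  rem-nonneg f c = sumTo-nonneg (len c) λ i i<n → when-nonneg (f c ℕ.≤? i) (w-nonneg c i i<n)

  score-nonneg : ∀ f c → 0ℚ ≤ score f c
  score-nonneg f c = +-nonneg (when-nonneg (0ℚ <? sumFin k (rem f)) (rem-nonneg f c))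
    (when-nonneg (sumFin k (rem f) ≤? 0ℚ) (when-nonneg (f c ℕ.<? len c) 0≤1))

  share-nonneg : ∀ f c → 0ℚ ≤ share f c
  share-nonneg f c = *-nonneg (score-nonneg f c) (inv-nonneg (sumFin k (score f)))

  share-sum≤1 : ∀ f → sumFin k (share f) ≤ 1ℚ
  share-sum≤1 f = ≤-trans (≤-reflexive (sumFin-*ʳ k (inv (sumFin k (score f))) (score f)))
    (*-inv≤1 (sumFin k (score f)))

  score≡rem : ∀ f → 0ℚ < sumFin k (rem f) → ∀ c → score f c ≡ rem f c
  score≡rem f pos c = trans (cong₂ _+_ (when-yes (0ℚ <? sumFin k (rem f)) pos)
    (when-no (sumFin k (rem f) ≤? 0ℚ) (λ ≤0 → <-irrefl refl (<-≤-trans pos ≤0)))) (+-identityʳ (rem f c))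

  -- Fronts at different times are only known to agree pointwise, which without extensionality is no
  -- equality of functions.
  share-cong : ∀ {f g} → (∀ c → f c ≡ g c) → ∀ c → share f c ≡ share g c
  share-cong {f} {g} f≡g c = cong₂ (λ a b → a * inv b) (score-cong c) (sumFin-cong k score-cong)
    where
    rem-cong : ∀ c → rem f c ≡ rem g c
    rem-cong c = cong (λ m → sumTo (len c) (λ i → when (m ℕ.≤? i) (w c i))) (f≡g c)
    score-cong : ∀ c → score f c ≡ score g c
    score-cong c = trans
      (cong (λ z → when (0ℚ <? z) (rem f c) + when (z ≤? 0ℚ) (pending f c)) (sumFin-cong k rem-cong))
      (cong₂ (λ a b → when (0ℚ <? sumFin k (rem g)) a + when (sumFin k (rem g) ≤? 0ℚ) b)
        (rem-cong c) (cong (λ m → when (m ℕ.<? len c) 1ℚ) (f≡g c)))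

  -- If weight remains, some chain has positive `rem`, and it is not exhausted because its sum would
  -- then vanish. Otherwise the unfinished chain `d` itself scores 1.
  served-chain : ∀ f d → f d ℕ.< len d → ∃[ c ] (f c ℕ.< len c) × (0ℚ < share f c)
  served-chain f d d< = let c , c< , 0<s = scored in
      c , c< , *-pos 0<s (inv-pos (sumFin k (score f)) (<-≤-trans 0<s (sumFin-term k (score-nonneg f) c)))
    where
    scored : ∃[ c ] (f c ℕ.< len c) × (0ℚ < score f c)
    scored with 0ℚ <? sumFin k (rem f)
    ... | no  ≮ = d , d< , subst (0ℚ <_) (sym (trans (+-identityˡ _)
            (trans (when-yes (sumFin k (rem f) ≤? 0ℚ) (≮⇒≥ ≮)) (when-yes (f d ℕ.<? len d) d<)))) (positive⁻¹ 1ℚ)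
    ... | yes pos with sumFin-pos k pos
    ...   | c , 0<rem = c , ℕ.≰⇒> (λ n≤f → <-irrefl refl (<-≤-trans 0<rem (≤-reflexive (trans
              (sumTo-cong< (len c) λ i i<n → when-no (f c ℕ.≤? i) (ℕ.<⇒≱ (ℕ.<-≤-trans i<n n≤f)))
              (sumTo-0 (len c))))))
            , <-≤-trans 0<rem (≤-+ʳ (when-nonneg (sumFin k (rem f) ≤? 0ℚ) (when-nonneg (f c ℕ.<? len c) 0≤1)))

  -- The strict comparison passes over jobs with `p = 0` at once, so they finish together with their
  -- predecessor, or at time 0.
  front : (Fin k → ℕ → ℚ) → Fin k → ℕ
  front v c = first (len c) (λ i → v c i <? p c i)

  -- `work t` counts slots `1, …, t`, and slot `suc t` is governed by the fronts reached after slot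
  -- `t`.
  work speed : ℕ → Fin k → ℕ → ℚ
  work zero    c i = 0ℚ
  work (suc t) c i = work t c i + speed (suc t) c i
  speed zero    c i = 0ℚ
  speed (suc t) c i = when (i ℕ.≟ front (work t) c) (share (front (work t)) c)

  F : ℕ → Fin k → ℕ
  F t = front (work t)

  speed-nonneg : ∀ t c i → 0ℚ ≤ speed t c i
  speed-nonneg zero    c i = ≤-refl
  speed-nonneg (suc t) c i = when-nonneg (i ℕ.≟ F t c) (share-nonneg (F t) c)

  F≤len : ∀ t c → F t c ℕ.≤ len c
  F≤len t c = first≤ (len c) (λ i → work t c i <? p c i)

  work<p : ∀ t c → F t c ℕ.< len c → work t c (F t c) < p c (F t c)
  work<p t c = first-hit (len c) (λ i → work t c i <? p c i)

  p≤work : ∀ t c {i} → i ℕ.< F t c → p c i ≤ work t c i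
  p≤work t c i<F = ≮⇒≥ (first-miss (len c) (λ i → work t c i <? p c i) i<F)

  -- Work never decreases, so a job once finished cannot become the front again.
  F-step : ∀ t c → F t c ℕ.≤ F (suc t) c
  F-step t c = ℕ.≮⇒≥ λ F′<F → <-irrefl refl (begin-strict
    p c (F (suc t) c)            ≤⟨ p≤work t c F′<F ⟩
    work t c (F (suc t) c)       ≤⟨ ≤-+ʳ (speed-nonneg (suc t) c (F (suc t) c)) ⟩
    work (suc t) c (F (suc t) c) <⟨ work<p (suc t) c (ℕ.<-≤-trans F′<F (F≤len t c)) ⟩
    p c (F (suc t) c)            ∎)

  F-mono-+ : ∀ c t n → F t c ℕ.≤ F (n ℕ.+ t) c
  F-mono-+ c t zero    = ℕ.≤-refl
  F-mono-+ c t (suc n) = ℕ.≤-trans (F-mono-+ c t n) (F-step (n ℕ.+ t) c)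

  F-mono : ∀ c {s t} → s ℕ.≤ t → F s c ℕ.≤ F t c
  F-mono c {s} {t} s≤t = subst (λ z → F s c ℕ.≤ F z c) (ℕ.m∸n+n≡m s≤t) (F-mono-+ c s (t ℕ.∸ s))

  work-nonneg : ∀ t c i → 0ℚ ≤ work t c i
  work-nonneg zero    c i = ≤-refl
  work-nonneg (suc t) c i = +-nonneg (work-nonneg t c i) (speed-nonneg (suc t) c i)

  stalled-work : ∀ t n → (∀ c → F (n ℕ.+ t) c ≡ F t c) → ∀ c →
    share (F t) c * toℚ n ≤ work (n ℕ.+ t) c (F t c)
  stalled-work t zero    same c = ≤-trans (≤-reflexive (*-zeroʳ (share (F t) c))) (work-nonneg t c (F t c))
  stalled-work t (suc n) same c = begin
    share (F t) c * toℚ (suc n)                ≡⟨ *-toℚ-suc (share (F t) c) n ⟩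
    share (F t) c * toℚ n + share (F t) c      ≤⟨ +-mono-≤ (stalled-work t n same′ c) (≤-reflexive (sym speed≡)) ⟩
    work (suc n ℕ.+ t) c (F t c)               ∎
    where
    -- Fronts are monotone in time, so agreement at both ends forces agreement in between.
    same′ : ∀ c → F (n ℕ.+ t) c ≡ F t c
    same′ c = ℕ.≤-antisym (subst (F (n ℕ.+ t) c ℕ.≤_) (same c) (F-step (n ℕ.+ t) c)) (F-mono-+ c t n)
    speed≡ : speed (suc (n ℕ.+ t)) c (F t c) ≡ share (F t) c
    speed≡ = trans (when-yes (F t c ℕ.≟ F (n ℕ.+ t) c) (sym (same′ c))) (share-cong same′ c)

  remaining : ℕ → ℕ
  remaining t = sumℕ k (λ c → len c ℕ.∸ F t c)

  -- As long as no job finishes the shares stay constant, so some front job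
  -- would eventually receive its full requirement.
  progress : ∀ t d → F t d ℕ.< len d → ∃[ t′ ] remaining t′ ℕ.< remaining t
  progress t d d< = let
      c , c< , 0<share = served-chain (F t) d d<
      n , p≤           = archimedean (share (F t) c) (p c (F t c)) 0<share
      moved            = λ same → <-irrefl refl (begin-strict
        p c (F t c)                  ≤⟨ p≤ ⟩
        share (F t) c * toℚ n        ≤⟨ stalled-work t n same c ⟩
        work (n ℕ.+ t) c (F t c)     ≡⟨ cong (work (n ℕ.+ t) c) (same c) ⟨
        work (n ℕ.+ t) c (F (n ℕ.+ t) c) <⟨ work<p (n ℕ.+ t) c (subst (ℕ._< len c) (sym (same c)) c<) ⟩
        p c (F (n ℕ.+ t) c)          ≡⟨ cong (p c) (same c) ⟩
        p c (F t c)                  ∎)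
      -- The contradiction only shows that some front has moved; the chain `e` found by finite
      -- search may differ from `c`.
      e , F≢           = ¬∀⟶∃¬ k _ (λ c → F (n ℕ.+ t) c ℕ.≟ F t c) moved
      F<               = ℕ.≤∧≢⇒< (F-mono-+ e t n) (F≢ ∘ sym)
    in n ℕ.+ t , sumℕ-mono-< k (λ c → ℕ.∸-monoʳ-≤ (len c) (F-mono-+ c t n)) e
         (ℕ.∸-monoʳ-< F< (F≤len (n ℕ.+ t) e))

  Done : Set
  Done = ∃[ T ] (∀ c → len c ℕ.≤ F T c)

  -- The fuel `n` bounds the number of unfinished jobs, and each call of `progress` pays for one
  -- unit of it.
  terminates : ∀ n t → remaining t ℕ.≤ n → Done
  continue : ∀ n t → remaining t ℕ.≤ n → ∃[ t′ ] remaining t′ ℕ.< remaining t → Done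
  terminates n t rem≤n = decide (all? (λ c → len c ℕ.≤? F t c))
    where
    decide : Dec (∀ c → len c ℕ.≤ F t c) → Done
    decide (yes done) = t , done
    decide (no ¬done) =
      let d , d≰ = ¬∀⟶∃¬ k (λ c → len c ℕ.≤ F t c) (λ c → len c ℕ.≤? F t c) ¬done
      in continue n t rem≤n (progress t d (ℕ.≰⇒> d≰))
  continue zero    t rem≤n (t′ , lt) = contradiction (ℕ.<-≤-trans lt rem≤n) ℕ.n≮0
  continue (suc n) t rem≤n (t′ , lt) = terminates n t′ (ℕ.≤-pred (ℕ.<-≤-trans lt rem≤n))

  -- Later arguments use only the property of the end time; `abstract` keeps the simulation from
  -- unfolding in types.
  abstract
    makespan : Done
    makespan = terminates (remaining 0) 0 ℕ.≤-refl

  T : ℕ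
  T = proj₁ makespan

  -- `suc T` candidates include time `T`, by which every job is done. The next four lemmas state,
  -- for jobs of the chain, that `finish c i ≤ t` is equivalent to `i < F t c`.
  finish : Fin k → ℕ → ℕ
  finish c i = first (suc T) (λ t → i ℕ.<? F t c)

  <finish⇒F≤ : ∀ c i {t} → t ℕ.< finish c i → F t c ℕ.≤ i
  <finish⇒F≤ c i lt = ℕ.≮⇒≥ (first-miss (suc T) (λ t → i ℕ.<? F t c) lt)

  <F⇒finish≤ : ∀ c i {t} → i ℕ.< F t c → finish c i ℕ.≤ t
  <F⇒finish≤ c i i<F = ℕ.≮⇒≥ λ lt → ℕ.<⇒≱ i<F (<finish⇒F≤ c i lt)

  finish≤⇒<F : ∀ c i {t} → i ℕ.< len c → finish c i ℕ.≤ t → i ℕ.< F t c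
  finish≤⇒<F c i i<n C≤t = ℕ.<-≤-trans
    (first-hit (suc T) (λ t → i ℕ.<? F t c) (s≤s (<F⇒finish≤ c i
      (ℕ.<-≤-trans i<n (proj₂ makespan c)))))
    (F-mono c C≤t)

  F≤⇒<finish : ∀ c i {t} → i ℕ.< len c → F t c ℕ.≤ i → t ℕ.< finish c i
  F≤⇒<finish c i i<n F≤i = ℕ.≰⇒> λ C≤t → ℕ.<⇒≱ (finish≤⇒<F c i i<n C≤t) F≤i

  -- Feasibility of the simulated schedule and its agreement with the algorithm

  A : Schedule I
  A = record { rate = speed ; comp = finish }

  processed≡work : ∀ c i t → processed A c i t ≡ work t c i
  processed≡work c i zero    = refl
  processed≡work c i (suc t) = cong (_+ speed (suc t) c i) (processed≡work c i t)

  feasible : Feasible A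
  feasible = record
    { rate-nonneg = λ t c i _ → speed-nonneg t c i
    ; capacity    = capacity
    ; precedence  = precedence
    ; comp-after  = comp-after
    ; comp-done   = λ c i i<n → subst (p c i ≤_) (sym (processed≡work c i (finish c i)))
                      (p≤work (finish c i) c (finish≤⇒<F c i i<n ℕ.≤-refl))
    ; comp-first  = λ c i i<n t r≤t t<C → subst (_< p c i) (sym (processed≡work c i t))
                      (unfinished c i i<n t (front≡ c i i<n t r≤t t<C))
    }
    where
    capacity : ∀ t → sumFin k (λ c → sumTo (len c) (λ i → speed t c i)) ≤ 1ℚ
    capacity zero    = ≤-trans (≤-reflexive (trans (sumFin-cong k λ c → sumTo-0 (len c)) (sumFin-0 k))) 0≤1
    capacity (suc t) = ≤-trans (sumFin-mono k λ c → sumTo-single≤ (len c) (F t c) (share-nonneg (F t) c))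
                               (share-sum≤1 (F t))
    precedence : ∀ t c i → i ℕ.< len c → t ℕ.≤ release A c i → speed t c i ≡ 0ℚ
    precedence zero    c i       _   _   = refl
    precedence (suc t) c (suc i) i<n t<r =
      when-no (suc i ℕ.≟ F t c) λ eq → ℕ.1+n≰n (subst (ℕ._≤ i) (sym eq) (<finish⇒F≤ c i t<r))
    comp-after : ∀ c i → i ℕ.< len c → release A c i ℕ.≤ finish c i
    comp-after c zero    _   = z≤n
    comp-after c (suc i) i<n = <F⇒finish≤ c i (ℕ.<-trans (ℕ.n<1+n i) (finish≤⇒<F c (suc i) i<n ℕ.≤-refl))
    -- Once the predecessor has finished the front is at least `i`, and until `i` finishes it is at
    -- most `i`.
    front≡ : ∀ c i → i ℕ.< len c → ∀ t → release A c i ℕ.≤ t → t ℕ.< finish c i → F t c ≡ i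
    front≡ c zero    i<n t r≤t t<C = ℕ.n≤0⇒n≡0 (<finish⇒F≤ c 0 t<C)
    front≡ c (suc i) i<n t r≤t t<C = ℕ.≤-antisym (<finish⇒F≤ c (suc i) t<C)
      (finish≤⇒<F c i (ℕ.<-trans (ℕ.n<1+n i) i<n) r≤t)
    unfinished : ∀ c i → i ℕ.< len c → ∀ t → F t c ≡ i → work t c i < p c i
    unfinished c i i<n t refl = work<p t c i<n

  open Weights A using (remW≡)

  -- Being unfinished at the start of slot `suc t` means not being finished after slot `t`, hence
  -- the shift by one.
  remW≡rem : ∀ c t → remW A c (suc t) ≡ rem (F t) c
  remW≡rem c t = trans (remW≡ c (suc t)) (sumTo-cong< (len c) λ i i<n →
    when-iff (suc t ℕ.≤? finish c i) (F t c ℕ.≤? i) (<finish⇒F≤ c i) (F≤⇒<finish c i i<n))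

  followsAlg : FollowsAlg A
  followsAlg (suc t) _ pos c i i<n = front-rate , other-rate
    where
    totW≡ : totW A (suc t) ≡ sumFin k (rem (F t))
    totW≡ = sumFin-cong k λ c → remW≡rem c t
    score≡ : ∀ c → score (F t) c ≡ remW A c (suc t)
    score≡ c = trans (score≡rem (F t) (subst (0ℚ <_) totW≡ pos) c) (sym (remW≡rem c t))
    front-rate : IsFront A c i (suc t) → speed (suc t) c i ≡ (remW A c (suc t) ÷ totW A (suc t)) {{>-nonZero pos}}
    front-rate (_ , t<C , before) = trans (when-yes (i ℕ.≟ F t c) (ℕ.≤-antisym i≤F (<finish⇒F≤ c i t<C)))
      (*-inv≡÷ (score≡ c) (sumFin-cong k score≡) pos)
      where
      i≤F : i ℕ.≤ F t c
      -- A front job before `i` would be complete by time `t`, and the front would lie beyond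
      -- itself.
      i≤F = ℕ.≮⇒≥ λ F<i → ℕ.<-irrefl refl
        (finish≤⇒<F c (F t c) (ℕ.<-trans F<i i<n) (ℕ.≤-pred (before (F t c) F<i)))
    other-rate : ¬ IsFront A c i (suc t) → speed (suc t) c i ≡ 0ℚ
    other-rate ¬front = when-no (i ℕ.≟ F t c) λ i≡F → ¬front
      ( i<n
      , F≤⇒<finish c i i<n (ℕ.≤-reflexive (sym i≡F))
      , λ i′ i′<i → s≤s (<F⇒finish≤ c i′ (subst (i′ ℕ.<_) i≡F i′<i)))

-- The existence half keeps the bound on the cost from holding vacuously.
theorem5 : (I : Instance) →
    (Σ (Schedule I) (λ A → Feasible A × FollowsAlg A)) ×
    (∀ (A : Schedule I) → Feasible A → FollowsAlg A →
     ∀ (S : Schedule I) → Feasible S → cost A ≤ (+ 4 / 1) * cost S)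
theorem5 I = (A , feasible , followsAlg) , Competitive.4-competitive
  where open Simulation I
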